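{- Let $n\ge 1$ and let $T$ be a triangulation of the grid-covered cylinder graph $G_{3,n}$ (three sectors). Then $T$ is word-representable if and only if $T$ contains none of the following six graphs $H_1,\dots,H_6$ as an induced subgraph: $H_1$: vertices $1,\dots,7$, edges $12,13,14,15,25,34,35,36,45,47,56,57,67$; $H_2$: vertices $1,\dots,7$, edges $12,13,14,15,23,25,26,34,36,45,46,47,56,57,67$; $H_3$: vertices $1,\dots,8$, edges $12,14,23,24,25,26,27,34,36,37,47,56,57,67,68,78$; $H_4$: vertices $1,\dots,8$, edges $12,13,14,23,24,25,26,27,34,36,37,47,56,57,58,67,78$; $H_5$: vertices $1,\dots,8$, edges $12,13,14,15,24,25,34,35,36,38,45,46,47,48,58,67,68,78$; $H_6$: vertices $1,\dots,8$, edges $12,14,15,23,25,34,35,36,37,45,46,47,57,67,68,78$.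
   Context: A simple graph $G=(V,E)$ is word-representable if there is a word $w$ over $V$, containing every letter of $V$, such that for distinct $x,y\in V$, $x$ and $y$ alternate in $w$ if and only if $xy\in E$. The grid-covered cylinder graph $G_{m,n}$ has vertex set $\{v_{ij}: 0\le i\le n,\ 0\le j\le m-1\}$, horizontal edges $v_{ij}v_{i,j+1}$ (second index mod $m$) and vertical edges $v_{ij}v_{i+1,j}$ ($0\le i\le n-1$). Its cells are the $mn$ 4-cycles $v_{ij}v_{i+1,j}v_{i+1,j+1}v_{i,j+1}$ (second index mod $m$). A triangulation of $G_{m,n}$ is obtained by adding, in each cell, exactly one of its two diagonals as an edge. In the edge lists, $ab$ denotes the edge between vertices $a$ and $b$. -}

module Defs where

open import Data.Nat using (ℕ; zero; suc)
open import Data.Fin using (Fin; zero; suc; toℕ; inject₁)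
open import Data.Fin.Properties using () renaming (_≟_ to _≟ᶠ_)
open import Data.Product using (Σ; ∃; _×_; _,_)
open import Data.Product.Properties using (≡-dec)
open import Data.Sum using (_⊎_)
open import Data.Bool using (Bool; true; false)
open import Data.List using (List; []; _∷_; filter)
open import Data.List.Membership.Propositional using (_∈_)
open import Data.List.Relation.Unary.Linked using (Linked)
open import Relation.Binary.PropositionalEquality using (_≡_; _≢_)
open import Relation.Binary.Definitions using (DecidableEquality)
open import Relation.Nullary.Decidable using (_⊎-dec_)
open import Relation.Nullary using (¬_)
open import Function.Bundles using (_⇔_)
open import Function.Definitions using (Injective)

restrict : {V : Set} → DecidableEquality V → V → V → List V → List V
restrict _≟_ x y w = filter (λ z → (z ≟ x) ⊎-dec (z ≟ y)) w

-- x and y alternate in w: after deleting all other letters, no letter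
-- is immediately followed by the same letter (i.e. the result is
-- xyxy... or yxyx...)
Alternate : {V : Set} → DecidableEquality V → V → V → List V → Set
Alternate _≟_ x y w = Linked _≢_ (restrict _≟_ x y w)

WordRepresentable : (V : Set) → DecidableEquality V → (V → V → Set) → Set
WordRepresentable V _≟_ Adj =
  Σ (List V) λ w →
    (∀ v → v ∈ w) ×
    (∀ x y → x ≢ y → (Alternate _≟_ x y w ⇔ Adj x y))

ContainsInduced : (k : ℕ) → (Fin k → Fin k → Set) → (V : Set) → (V → V → Set) → Set
ContainsInduced k EH V Adj =
  Σ (Fin k → V) λ f →
    Injective _≡_ _≡_ f ×
    (∀ a b → a ≢ b → (EH a b ⇔ Adj (f a) (f b)))

-- vertex v_{ij} with 0 ≤ i ≤ n, 0 ≤ j ≤ 2 is the pair (i , j)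
CylV : ℕ → Set
CylV n = Fin (suc n) × Fin 3

cylV-≟ : (n : ℕ) → DecidableEquality (CylV n)
cylV-≟ n = ≡-dec _≟ᶠ_ _≟ᶠ_

next3 : Fin 3 → Fin 3
next3 zero = suc zero
next3 (suc zero) = suc (suc zero)
next3 (suc (suc zero)) = zero

-- A triangulation: for every cell (i , j) (0 ≤ i ≤ n-1, 0 ≤ j ≤ 2), the
-- choice of diagonal.  true  : v_{i,j} v_{i+1,j+1}
--                      false : v_{i+1,j} v_{i,j+1}
Triangulation : ℕ → Set
Triangulation n = Fin n → Fin 3 → Bool

data TriEdge {n : ℕ} (t : Triangulation n) : CylV n → CylV n → Set where
  horiz : ∀ (i : Fin (suc n)) j → TriEdge t (i , j) (i , next3 j)
  vert  : ∀ (i : Fin n) j → TriEdge t (inject₁ i , j) (suc i , j)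
  diag₁ : ∀ (i : Fin n) j → t i j ≡ true  → TriEdge t (inject₁ i , j) (suc i , next3 j)
  diag₂ : ∀ (i : Fin n) j → t i j ≡ false → TriEdge t (suc i , j) (inject₁ i , next3 j)

TriAdj : {n : ℕ} → Triangulation n → CylV n → CylV n → Set
TriAdj t x y = TriEdge t x y ⊎ TriEdge t y x

-- graph on Fin k from an edge list of 1-based labels
EdgeListAdj : (k : ℕ) → List (ℕ × ℕ) → Fin k → Fin k → Set
EdgeListAdj k es a b = ((suc (toℕ a) , suc (toℕ b)) ∈ es) ⊎ ((suc (toℕ b) , suc (toℕ a)) ∈ es)

H₁-edges H₂-edges H₃-edges H₄-edges H₅-edges H₆-edges : List (ℕ × ℕ)
H₁-edges = (1 , 2) ∷ (1 , 3) ∷ (1 , 4) ∷ (1 , 5) ∷ (2 , 5) ∷ (3 , 4) ∷ (3 , 5) ∷ (3 , 6) ∷ (4 , 5) ∷ (4 , 7) ∷ (5 , 6) ∷ (5 , 7) ∷ (6 , 7) ∷ []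
H₂-edges = (1 , 2) ∷ (1 , 3) ∷ (1 , 4) ∷ (1 , 5) ∷ (2 , 3) ∷ (2 , 5) ∷ (2 , 6) ∷ (3 , 4) ∷ (3 , 6) ∷ (4 , 5) ∷ (4 , 6) ∷ (4 , 7) ∷ (5 , 6) ∷ (5 , 7) ∷ (6 , 7) ∷ []
H₃-edges = (1 , 2) ∷ (1 , 4) ∷ (2 , 3) ∷ (2 , 4) ∷ (2 , 5) ∷ (2 , 6) ∷ (2 , 7) ∷ (3 , 4) ∷ (3 , 6) ∷ (3 , 7) ∷ (4 , 7) ∷ (5 , 6) ∷ (5 , 7) ∷ (6 , 7) ∷ (6 , 8) ∷ (7 , 8) ∷ []
H₄-edges = (1 , 2) ∷ (1 , 3) ∷ (1 , 4) ∷ (2 , 3) ∷ (2 , 4) ∷ (2 , 5) ∷ (2 , 6) ∷ (2 , 7) ∷ (3 , 4) ∷ (3 , 6) ∷ (3 , 7) ∷ (4 , 7) ∷ (5 , 6) ∷ (5 , 7) ∷ (5 , 8) ∷ (6 , 7) ∷ (7 , 8) ∷ []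
H₅-edges = (1 , 2) ∷ (1 , 3) ∷ (1 , 4) ∷ (1 , 5) ∷ (2 , 4) ∷ (2 , 5) ∷ (3 , 4) ∷ (3 , 5) ∷ (3 , 6) ∷ (3 , 8) ∷ (4 , 5) ∷ (4 , 6) ∷ (4 , 7) ∷ (4 , 8) ∷ (5 , 8) ∷ (6 , 7) ∷ (6 , 8) ∷ (7 , 8) ∷ []
H₆-edges = (1 , 2) ∷ (1 , 4) ∷ (1 , 5) ∷ (2 , 3) ∷ (2 , 5) ∷ (3 , 4) ∷ (3 , 5) ∷ (3 , 6) ∷ (3 , 7) ∷ (4 , 5) ∷ (4 , 6) ∷ (4 , 7) ∷ (5 , 7) ∷ (6 , 7) ∷ (6 , 8) ∷ (7 , 8) ∷ []

TContains : {n : ℕ} → Triangulation n → (k : ℕ) → List (ℕ × ℕ) → Set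
TContains {n} t k es = ContainsInduced k (EdgeListAdj k es) (CylV n) (TriAdj t)

{-# OPTIONS --safe #-}
module Submission where

-- A word representing a graph orients each edge xy from the letter that leads: in every prefix x occurs
-- as often as y or once more. Prefix counts decrease along directed paths, so this orientation is
-- acyclic and, if a → b → c → d and a → d, then also a → c and b → d. None of H₁, …, H₆ has such an
-- orientation.
--
-- Conversely, two consecutive layers of cells whose diagonals neither all agree nor are all opposite
-- contain H₁, H₄ or H₅. If no such layers occur, the triangulation has a proper 4-colouring such that,
-- with edges oriented towards the larger colour, a → b → c → d and a – d imply a – c and b – d.
-- An orientation of this kind yields a representing word: for every vertex v one writes a word in which
-- each letter occurs twice, all edges alternate, and v alternates with its neighbours only.

open import Defs
open import Data.Bool using (Bool; true; false; if_then_else_; not; _∧_; _∨_; T)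
import Data.Bool.Properties as Boolₚ
open import Data.Bool.Properties using (T-∧; T-≡)
open import Data.Empty using (⊥; ⊥-elim)
open import Data.Fin using (Fin; zero; suc; toℕ; inject₁; fromℕ<; _<_; _<?_; _↑ˡ_)
import Data.Fin.Properties as Finₚ
open import Data.List using (List; []; _∷_; _++_; filter; filterᵇ; map; mapMaybe; concatMap; length; upTo)
open import Data.List using (allFin; cartesianProduct)
open import Data.List.Properties using (filter-≐; filter-++; filter-none; concatMap-cong)
open import Data.List.Membership.Propositional using (_∈_; lose)
open import Data.List.Membership.Propositional.Properties using (∈-concatMap⁺; ∈-filter⁺; ∈-allFin; ∈-cartesianProduct⁺)
import Data.List.Membership.DecPropositional as DecMembership
open import Data.List.Relation.Unary.All as All using (All; []; _∷_)
import Data.List.Relation.Unary.All.Properties as All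
open import Data.List.Relation.Unary.AllPairs using ([]; _∷_)
open import Data.List.Relation.Unary.Any as Any using (Any; here; there; any?)
open import Data.List.Relation.Unary.Linked as Linked using (Linked; []; [-]; _∷_)
open import Data.List.Relation.Unary.Unique.Propositional using (Unique)
import Data.List.Relation.Unary.Unique.Propositional.Properties as Unique
open import Data.Maybe as Maybe using (Maybe; just; nothing; is-just; _<∣>_)
open import Data.Maybe.Relation.Unary.All using (just; nothing) renaming (All to AllMaybe)
open import Data.Nat as ℕ using (ℕ; zero; suc; _+_; _≤_; _≥_; _≤ᵇ_; _<ᵇ_; _≡ᵇ_; z≤n; s≤s)
open import Data.Nat.DivMod using (_mod_)
import Data.Nat.Properties as ℕₚ
open import Data.Product using (∃; _×_; _,_; proj₁; proj₂; swap)
open import Data.Product.Properties using (≡-dec; ,-injectiveˡ; ,-injectiveʳ)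
open import Data.Sum as Sum using (_⊎_; inj₁; inj₂)
open import Data.Unit using (tt)
open import Data.Vec as Vec using (Vec; []; _∷_; lookup; tabulate)
import Data.Vec.Properties as Vec
open import Function using (_∘_; id)
open import Function.Bundles using (_⇔_; mk⇔; Equivalence)
open import Relation.Binary.Definitions using (Decidable; DecidableEquality; Tri; tri<; tri≈; tri>)
open import Relation.Binary.PropositionalEquality using (_≡_; _≢_; refl; sym; trans; cong; cong₂; subst; subst₂)
open import Relation.Nullary using (¬_; Dec; yes; no; does; contradiction)
open import Relation.Nullary.Decidable using (_×-dec_; _⊎-dec_; _→-dec_; ¬?; map′; dec-true; decidable-stable)
open import Relation.Unary using () renaming (Decidable to Decidable₁)

-- Non-representability of the six graphs

-- Only directed cycles and shortcuts on at most four vertices are recorded; these suffice to rule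
-- out the six graphs. The relation is reflexive, so padding with `⟶-refl` lets `acyclic` exclude
-- directed 2-cycles and triangles as well.
record SemiTransitive {V : Set} (Adj : V → V → Set) : Set₁ where
  infix 4 _⟶_
  field
    _⟶_      : V → V → Set
    ⟶-refl   : ∀ {a} → a ⟶ a
    oriented : ∀ {a b} → a ≢ b → Adj a b → a ⟶ b ⊎ b ⟶ a
    adjacent : ∀ {a b} → a ≢ b → a ⟶ b → Adj a b
    acyclic  : ∀ {a b c d} → a ⟶ b → b ⟶ c → c ⟶ d → d ⟶ a → a ≡ b
    shortcut : ∀ {a b c d} → a ⟶ b → b ⟶ c → c ⟶ d → a ⟶ d → (a ⟶ c) × (b ⟶ d)

restrict-comm : ∀ {V : Set} (_≟_ : DecidableEquality V) x y w → restrict _≟_ x y w ≡ restrict _≟_ y x w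
restrict-comm _≟_ x y = filter-≐ (λ z → (z ≟ x) ⊎-dec (z ≟ y)) (λ z → (z ≟ y) ⊎-dec (z ≟ x)) (Sum.swap , Sum.swap)

module Occurrences {V : Set} (_≟_ : DecidableEquality V) where

  occ : V → ℕ → List V → ℕ
  occ x zero    w       = 0
  occ x (suc i) []      = 0
  occ x (suc i) (z ∷ w) = if does (z ≟ x) then suc (occ x i w) else occ x i w

  -- For x ≢ y: the letters x and y alternate in w, and x comes first if either occurs.
  Leads : List V → V → V → Set
  Leads w x y = ∀ i → occ y i w ≤ occ x i w × occ x i w ≤ suc (occ y i w)

  -- The prepended y encodes that the restriction does not begin with y. Once an x has been read, y
  -- leads the rest, and the two inequalities change places.
  linked⇒leads : ∀ {x y} → x ≢ y → ∀ w → Linked _≢_ (y ∷ restrict _≟_ x y w) → Leads w x y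
  linked⇒leads x≢y w  l zero    = z≤n , z≤n
  linked⇒leads x≢y [] l (suc i) = z≤n , z≤n
  linked⇒leads {x} {y} x≢y (z ∷ w) l (suc i) with z ≟ x | z ≟ y
  ... | yes refl | yes refl = ⊥-elim (x≢y refl)
  ... | yes refl | no _
    with (p , q) ← linked⇒leads (x≢y ∘ sym) w (subst (λ r → Linked _≢_ (x ∷ r)) (restrict-comm _≟_ x y w) (Linked.tail l)) i
    = q , s≤s p
  ... | no _ | yes refl = ⊥-elim (Linked.head l refl)
  ... | no _ | no _ = linked⇒leads x≢y w l i

  leads⇒linked : ∀ {x y} → x ≢ y → ∀ w → Leads w x y → Linked _≢_ (y ∷ restrict _≟_ x y w)
  leads⇒linked x≢y [] l = [-]
  leads⇒linked {x} {y} x≢y (z ∷ w) l with z ≟ x | z ≟ y | l ∘ suc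
  ... | yes refl | yes refl | _ = ⊥-elim (x≢y refl)
  ... | yes refl | no _ | l′
    = (x≢y ∘ sym) ∷ subst (λ r → Linked _≢_ (x ∷ r)) (restrict-comm _≟_ y x w)
        (leads⇒linked (x≢y ∘ sym) w λ i → ℕₚ.≤-pred (proj₂ (l′ i)) , proj₁ (l′ i))
  -- In the prefix of length one, y would occur once and x not at all.
  ... | no _ | yes refl | l′ = contradiction (proj₁ (l′ 0)) λ ()
  ... | no _ | no _ | l′ = leads⇒linked x≢y w l′

  alternate⇒leads : ∀ {x y} → x ≢ y → ∀ w → Alternate _≟_ x y w → Leads w x y ⊎ Leads w y x
  alternate⇒leads {x} {y} x≢y w alt = go (restrict _≟_ x y w) refl
    where
    go : ∀ r → restrict _≟_ x y w ≡ r → Leads w x y ⊎ Leads w y x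
    go [] e = inj₁ (linked⇒leads x≢y w (subst (λ r → Linked _≢_ (y ∷ r)) (sym e) [-]))
    go (z ∷ r) e with All.head (subst (All _) e (All.all-filter (λ z → (z ≟ x) ⊎-dec (z ≟ y)) w))
    ... | inj₁ refl = inj₁ (linked⇒leads x≢y w
            (subst (λ r → Linked _≢_ (y ∷ r)) (sym e) ((x≢y ∘ sym) ∷ subst (Linked _≢_) e alt)))
    ... | inj₂ refl = inj₂ (linked⇒leads (x≢y ∘ sym) w
            (subst (λ r → Linked _≢_ (x ∷ r)) (trans (sym e) (restrict-comm _≟_ x y w)) (x≢y ∷ subst (Linked _≢_) e alt)))

  -- The first letter of w that is x or y would separate the two counts; x ∈ w ensures that there is
  -- one.
  same-occ⇒≡ : ∀ {x y w} → x ∈ w → (∀ i → occ x i w ≡ occ y i w) → x ≡ y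
  same-occ⇒≡ {x} {y} {z ∷ w} p e with z ≟ x | z ≟ y | e 1 | e ∘ suc | p
  ... | yes refl | yes refl | _  | _  | _        = refl
  ... | yes refl | no _     | () | _  | _
  ... | no _     | yes _    | () | _  | _
  ... | no z≢x   | no _     | _  | _  | here x≡z = ⊥-elim (z≢x (sym x≡z))
  ... | no _     | no _     | _  | e′ | there q  = same-occ⇒≡ q e′

  -- Counts weakly decrease along arcs, so they are constant around a directed cycle. For a path
  -- from a to d with a ⟶ d, the counts of b and c lie between those of a and d, which differ by at
  -- most one.
  representable⇒semiTransitive : ∀ {Adj} → WordRepresentable V _≟_ Adj → SemiTransitive Adj
  representable⇒semiTransitive (w , all∈ , represents) = record
    { _⟶_      = Leads w
    ; ⟶-refl   = λ i → ℕₚ.≤-refl , ℕₚ.n≤1+n _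
    ; oriented = λ a≢b ab → alternate⇒leads a≢b w (Equivalence.from (represents _ _ a≢b) ab)
    ; adjacent = λ a≢b l → Equivalence.to (represents _ _ a≢b) (Linked.tail (leads⇒linked a≢b w l))
    ; acyclic  = λ ab bc cd da → same-occ⇒≡ (all∈ _) λ i → ℕₚ.≤-antisym
        (ℕₚ.≤-trans (proj₁ (da i)) (ℕₚ.≤-trans (proj₁ (cd i)) (proj₁ (bc i)))) (proj₁ (ab i))
    ; shortcut = λ ab bc cd ad →
        (λ i → ℕₚ.≤-trans (proj₁ (bc i)) (proj₁ (ab i)) , ℕₚ.≤-trans (proj₂ (ad i)) (s≤s (proj₁ (cd i)))) ,
        (λ i → ℕₚ.≤-trans (proj₁ (cd i)) (proj₁ (bc i)) , ℕₚ.≤-trans (proj₁ (ab i)) (proj₂ (ad i)))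
    }

pullback : ∀ {V W : Set} {Adj : V → V → Set} {AdjW : W → W → Set} (f : W → V) →
  (∀ {a b} → f a ≡ f b → a ≡ b) → (∀ a b → a ≢ b → (AdjW a b ⇔ Adj (f a) (f b))) →
  SemiTransitive Adj → SemiTransitive AdjW
pullback f inj iso S = record
  { _⟶_      = λ a b → f a ⟶ f b
  ; ⟶-refl   = ⟶-refl
  ; oriented = λ a≢b ab → oriented (a≢b ∘ inj) (Equivalence.to (iso _ _ a≢b) ab)
  ; adjacent = λ a≢b ab → Equivalence.from (iso _ _ a≢b) (adjacent (a≢b ∘ inj) ab)
  ; acyclic  = λ ab bc cd da → inj (acyclic ab bc cd da)
  ; shortcut = shortcut
  }
  where open SemiTransitive S

witness : ∀ {P : Set} (P? : Dec P) → does P? ≡ true → P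
witness (yes p) _ = p

-- Refuting semi-transitive orientations by propositional search

module Refutation {V : Set} (_≟_ : DecidableEquality V) {Adj : V → V → Set} (adj? : Decidable Adj) (vertex : ℕ → V) where

  -- Arcs carry numerals rather than vertices, which makes comparing them cheap. A clause asserts that
  -- one of its arcs belongs to the orientation.
  Arc Clause : Set
  Arc = ℕ × ℕ
  Clause = List Arc

  Quad : Set
  Quad = ℕ × ℕ × ℕ × ℕ

  _~_ : ℕ → ℕ → Set
  a ~ b = Adj (vertex a) (vertex b) × vertex a ≢ vertex b

  _~?_ : Decidable _~_
  a ~? b = adj? (vertex a) (vertex b) ×-dec ¬? (vertex a ≟ vertex b)

  -- The directed path a → b → c → d cannot occur: it closes up to a cyclic triangle (d = a) or,
  -- whichever way the edge ad points, to a directed 4-cycle or a shortcut.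
  Closes : ℕ → ℕ → ℕ → ℕ → Set
  Closes a b c d = vertex d ≡ vertex a ⊎ (a ~ d × vertex a ≢ vertex c × vertex b ≢ vertex d × (¬ a ~ c ⊎ ¬ b ~ d))

  Forbidden : Quad → Set
  Forbidden (a , b , c , d) =
    a ~ b × b ~ c × c ~ d × Closes a b c d

  forbidden? : ∀ q → Dec (Forbidden q)
  forbidden? (a , b , c , d) =
    a ~? b ×-dec b ~? c ×-dec c ~? d ×-dec
    (vertex d ≟ vertex a ⊎-dec (a ~? d ×-dec ¬? (vertex a ≟ vertex c) ×-dec ¬? (vertex b ≟ vertex d) ×-dec
      (¬? (a ~? c) ⊎-dec ¬? (b ~? d))))

  -- One of the three edges of the forbidden path has to point backwards.
  clause : Quad → Clause
  clause (a , b , c , d) = (b , a) ∷ (c , b) ∷ (d , c) ∷ []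

  quads : ℕ → List Quad
  quads k = cartesianProduct (upTo k) (cartesianProduct (upTo k) (cartesianProduct (upTo k) (upTo k)))

  clauses : ℕ → List Clause
  clauses k = map clause (filter forbidden? (quads k))

  _==_ : Arc → Arc → Bool
  (a , b) == (c , d) = (a ≡ᵇ c) ∧ (b ≡ᵇ d)

  -- The result `nothing` means that l satisfies the clause, which is then dropped. The reverse of l
  -- has become false and is deleted.
  assumeIn : Arc → Clause → Maybe Clause
  assumeIn l []      = just []
  assumeIn l (m ∷ c) = if l == m then nothing else (if swap l == m then assumeIn l c else Maybe.map (m ∷_) (assumeIn l c))

  assume : Arc → List Clause → List Clause
  assume l = mapMaybe (assumeIn l)

  -- Splitting on a shortest clause subsumes unit propagation: an empty clause closes the branch at
  -- once, and the wrong orientation of a one-arc clause makes it empty.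
  shortest : Clause → List Clause → Clause
  shortest c []       = c
  shortest c (d ∷ ds) = if length d <ᵇ length c then shortest d ds else shortest c ds

  -- Backtracking on the orientation of an edge in a shortest clause; the number bounds the depth.
  unsat : ℕ → List Clause → Bool
  splitOn : ℕ → Clause → List Clause → Bool
  unsat zero    _        = false
  unsat (suc n) []       = false
  unsat (suc n) (c ∷ cs) = splitOn n (shortest c cs) (c ∷ cs)
  splitOn n []            cs = true
  -- The test that ab is an edge guarantees that one of the two branches describes the orientation.
  splitOn n ((a , b) ∷ _) cs = does (a ~? b) ∧ (unsat n (assume (a , b) cs) ∧ unsat n (assume (b , a) cs))

  module _ (S : SemiTransitive Adj) where
    open SemiTransitive S

    -- Distinctness is demanded because `_⟶_` is reflexive.
    Holds : Arc → Set
    Holds (a , b) = vertex a ≢ vertex b × (vertex a ⟶ vertex b)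

    Valid : List Clause → Set
    Valid = All (Any Holds)

    orient : ∀ {a b} → a ~ b → Holds (a , b) ⊎ Holds (b , a)
    orient (ab , a≢b) = Sum.map (a≢b ,_) (a≢b ∘ sym ,_) (oriented a≢b ab)

    forbidden-valid : ∀ q → Forbidden q → Any Holds (clause q)
    forbidden-valid (a , b , c , d) (ab , bc , cd , close) with orient ab | orient bc | orient cd
    ... | inj₂ ba  | _       | _       = here ba
    ... | inj₁ _   | inj₂ cb | _       = there (here cb)
    ... | inj₁ _   | inj₁ _  | inj₂ dc = there (there (here dc))
    ... | inj₁ (a≢b , a⟶b) | inj₁ (_ , b⟶c) | inj₁ (_ , c⟶d) = ⊥-elim (impossible close)
      where
      impossible : ¬ Closes a b c d
      impossible (inj₁ d≡a) = a≢b (acyclic a⟶b b⟶c c⟶d (subst (_⟶ vertex a) (sym d≡a) ⟶-refl))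
      impossible (inj₂ (ad , a≢c , b≢d , missing)) with orient ad
      ... | inj₂ (_ , d⟶a) = a≢b (acyclic a⟶b b⟶c c⟶d d⟶a)
      ... | inj₁ (_ , a⟶d) with shortcut a⟶b b⟶c c⟶d a⟶d | missing
      ... | a⟶c , _ | inj₁ ¬ac = ¬ac (adjacent a≢c a⟶c , a≢c)
      ... | _ , b⟶d | inj₂ ¬bd = ¬bd (adjacent b≢d b⟶d , b≢d)

    clauses-valid : ∀ k → Valid (clauses k)
    clauses-valid k = All.map⁺ (All.map (λ {q} → forbidden-valid q) (All.all-filter forbidden? (quads k)))

    ==⇒≡ : ∀ l m → T (l == m) → l ≡ m
    ==⇒≡ (a , b) (c , d) e with (p , q) ← Equivalence.to T-∧ e = cong₂ _,_ (ℕₚ.≡ᵇ⇒≡ a c p) (ℕₚ.≡ᵇ⇒≡ b d q)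

    assumeIn-valid : ∀ {l} c → Holds l → Any Holds c → AllMaybe (Any Holds) (assumeIn l c)
    assumeIn-valid {l} (m ∷ c) h p with l == m | swap l == m | ==⇒≡ (swap l) m | p
    ... | true  | _     | _ | _ = nothing
    ... | false | true  | e | there q = assumeIn-valid c h q
    ... | false | true  | e | here (b≢a , b⟶a) with refl ← e tt = ⊥-elim (b≢a (acyclic b⟶a (proj₂ h) ⟶-refl ⟶-refl))
    ... | false | false | _ | here r with assumeIn l c
    ...   | nothing = nothing
    ...   | just _  = just (here r)
    assumeIn-valid {l} (m ∷ c) h p | false | false | _ | there q with assumeIn l c | assumeIn-valid c h q
    ...   | nothing | _      = nothing
    ...   | just _  | just r = just (there r)

    assume-valid : ∀ {l} cs → Holds l → Valid cs → Valid (assume l cs)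
    assume-valid     []       h []      = []
    assume-valid {l} (c ∷ cs) h (p ∷ v) with assumeIn l c | assumeIn-valid c h p
    ... | nothing | _      = assume-valid cs h v
    ... | just _  | just q = q ∷ assume-valid cs h v

    shortest-valid : ∀ c cs → Any Holds c → Valid cs → Any Holds (shortest c cs)
    shortest-valid c []       p []       = p
    shortest-valid c (d ∷ ds) p (q ∷ qs) with length d <ᵇ length c
    ... | true  = shortest-valid d ds q qs
    ... | false = shortest-valid c ds p qs

    unsat-sound : ∀ n cs → T (unsat n cs) → ¬ Valid cs
    splitOn-sound : ∀ n c cs → T (splitOn n c cs) → Any Holds c → ¬ Valid cs
    unsat-sound (suc n) (c ∷ cs) u v@(p ∷ q) = splitOn-sound n (shortest c cs) (c ∷ cs) u (shortest-valid c cs p q) v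
    splitOn-sound n ((a , b) ∷ _) cs u _ v with (u₀ , u′) ← Equivalence.to T-∧ u
      with (u₁ , u₂) ← Equivalence.to T-∧ u′ | orient {a} {b} (witness (a ~? b) (Equivalence.to T-≡ u₀))
    ... | inj₁ ab = unsat-sound n _ u₁ (assume-valid cs ab v)
    ... | inj₂ ba = unsat-sound n _ u₂ (assume-valid cs ba v)

  refutes : ∀ n k → unsat n (clauses k) ≡ true → ¬ SemiTransitive Adj
  refutes n k u S = unsat-sound S n (clauses k) (Equivalence.from T-≡ u) (clauses-valid S k)

edgeListAdj? : ∀ k es → Decidable (EdgeListAdj k es)
edgeListAdj? k es a b = ((suc (toℕ a) , suc (toℕ b)) ∈? es) ⊎-dec ((suc (toℕ b) , suc (toℕ a)) ∈? es)
  where open DecMembership (≡-dec ℕₚ._≟_ ℕₚ._≟_) using (_∈?_)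

-- The search is run by evaluation: 20 bounds its depth, 7 is the number of vertices, and numeral i
-- stands for the vertex labelled i + 1.
H₁-not-semiTransitive : ¬ SemiTransitive (EdgeListAdj 7 H₁-edges)
H₁-not-semiTransitive = Refutation.refutes Finₚ._≟_ (edgeListAdj? 7 H₁-edges) (_mod 7) 20 7 refl

H₂-not-semiTransitive : ¬ SemiTransitive (EdgeListAdj 7 H₂-edges)
H₂-not-semiTransitive = Refutation.refutes Finₚ._≟_ (edgeListAdj? 7 H₂-edges) (_mod 7) 20 7 refl

H₃-not-semiTransitive : ¬ SemiTransitive (EdgeListAdj 8 H₃-edges)
H₃-not-semiTransitive = Refutation.refutes Finₚ._≟_ (edgeListAdj? 8 H₃-edges) (_mod 8) 20 8 refl

H₄-not-semiTransitive : ¬ SemiTransitive (EdgeListAdj 8 H₄-edges)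
H₄-not-semiTransitive = Refutation.refutes Finₚ._≟_ (edgeListAdj? 8 H₄-edges) (_mod 8) 20 8 refl

H₅-not-semiTransitive : ¬ SemiTransitive (EdgeListAdj 8 H₅-edges)
H₅-not-semiTransitive = Refutation.refutes Finₚ._≟_ (edgeListAdj? 8 H₅-edges) (_mod 8) 20 8 refl

H₆-not-semiTransitive : ¬ SemiTransitive (EdgeListAdj 8 H₆-edges)
H₆-not-semiTransitive = Refutation.refutes Finₚ._≟_ (edgeListAdj? 8 H₆-edges) (_mod 8) 20 8 refl

-- Words from four-colourings

Linked-++⁻ˡ : ∀ {A : Set} {R : A → A → Set} xs {ys} → Linked R (xs ++ ys) → Linked R xs
Linked-++⁻ˡ []           l       = []
Linked-++⁻ˡ (x ∷ [])     l       = [-]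
Linked-++⁻ˡ (x ∷ y ∷ xs) (r ∷ l) = r ∷ Linked-++⁻ˡ (y ∷ xs) l

Linked-++⁻ʳ : ∀ {A : Set} {R : A → A → Set} xs {ys} → Linked R (xs ++ ys) → Linked R ys
Linked-++⁻ʳ []       l = l
Linked-++⁻ʳ (x ∷ xs) l = Linked-++⁻ʳ xs (Linked.tail l)

Linked-concatMap⁻ : ∀ {A B : Set} {R : B → B → Set} {f : A → List B} {x xs} →
  x ∈ xs → Linked R (concatMap f xs) → Linked R (f x)
Linked-concatMap⁻ {f = f} {x}          (here refl) l = Linked-++⁻ˡ (f x) l
Linked-concatMap⁻ {f = f} {xs = y ∷ _} (there p)   l = Linked-concatMap⁻ p (Linked-++⁻ʳ (f y) l)

filter-comm : ∀ {A : Set} {P Q : A → Set} (P? : Decidable₁ P) (Q? : Decidable₁ Q) xs →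
  filter P? (filter Q? xs) ≡ filter Q? (filter P? xs)
filter-comm P? Q? [] = refl
filter-comm P? Q? (x ∷ xs) with does (Q? x) in q | does (P? x) in p
... | false | false = filter-comm P? Q? xs
... | false | true  rewrite q = filter-comm P? Q? xs
... | true  | false rewrite p = filter-comm P? Q? xs
... | true  | true  rewrite p | q = cong (x ∷_) (filter-comm P? Q? xs)

-- A stable bucket sort if the slots are distinct. A slot listed twice repeats its bucket, which is
-- how a block comes to contain each letter twice.
arrange : ∀ {A : Set} {m} → (A → Fin m) → List (Fin m) → List A → List A
arrange g slots l = concatMap (λ k → filter (λ x → g x Finₚ.≟ k) l) slots

module Restrict {V : Set} (_≟_ : DecidableEquality V) where

  restrict-concatMap : ∀ {B : Set} x y (f : B → List V) bs →
    restrict _≟_ x y (concatMap f bs) ≡ concatMap (restrict _≟_ x y ∘ f) bs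
  restrict-concatMap x y f []       = refl
  restrict-concatMap x y f (b ∷ bs) = trans (filter-++ _ (f b) (concatMap f bs))
    (cong (restrict _≟_ x y (f b) ++_) (restrict-concatMap x y f bs))

  -- Filters commute. Hence alternation of x and y in an arranged list can be read off from
  -- arranging a list of just these two letters.
  restrict-arrange : ∀ {m} x y (g : V → Fin m) slots l →
    restrict _≟_ x y (arrange g slots l) ≡ arrange g slots (restrict _≟_ x y l)
  restrict-arrange x y g []          l = refl
  restrict-arrange x y g (k ∷ slots) l = trans (filter-++ _ (filter _ l) (arrange g slots l))
    (cong₂ _++_ (filter-comm _ _ l) (restrict-arrange x y g slots l))

  restrict-∉ : ∀ x y {l} → All (x ≢_) l → All (y ≢_) l → restrict _≟_ x y l ≡ []
  restrict-∉ x y p q = filter-none _ (All.zipWith (λ { (x≢z , y≢z) (inj₁ e) → x≢z (sym e)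
                                                    ; (x≢z , y≢z) (inj₂ e) → y≢z (sym e) }) (p , q))

  restrict-one : ∀ x y {l} → Unique l → y ∈ l → All (x ≢_) l → restrict _≟_ x y l ≡ y ∷ []
  restrict-one x y {z ∷ l} (u ∷ us) p (x≢z ∷ x∉) with z ≟ x | z ≟ y | p
  ... | yes refl | _        | _         = ⊥-elim (x≢z refl)
  ... | no _     | yes refl | _         = cong (z ∷_) (restrict-∉ x z x∉ u)
  ... | no _     | no z≢y   | here refl = ⊥-elim (z≢y refl)
  ... | no _     | no _     | there q   = restrict-one x y us q x∉

  restrict-unique : ∀ {x y l} → x ≢ y → Unique l → x ∈ l → y ∈ l →
    restrict _≟_ x y l ≡ x ∷ y ∷ [] ⊎ restrict _≟_ x y l ≡ y ∷ x ∷ []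
  restrict-unique {x} {y} {z ∷ l} x≢y (u ∷ us) p q with z ≟ x | z ≟ y | p | q
  ... | yes refl | yes refl | _         | _         = ⊥-elim (x≢y refl)
  ... | yes refl | no z≢y   | _         | here refl = ⊥-elim (z≢y refl)
  ... | yes refl | no _     | _         | there q′  = inj₁ (cong (x ∷_) (restrict-one x y us q′ u))
  ... | no z≢x   | yes refl | here refl | _         = ⊥-elim (z≢x refl)
  ... | no _     | yes refl | there p′  | _         =
    inj₂ (cong (y ∷_) (trans (restrict-comm _≟_ x y l) (restrict-one y x us p′ u)))
  ... | no z≢x   | no _     | here refl | _         = ⊥-elim (z≢x refl)
  ... | no _     | no z≢y   | there _   | here refl = ⊥-elim (z≢y refl)
  ... | no _     | no _     | there p′  | there q′  = restrict-unique x≢y us p′ q′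

arrange-pair : ∀ {A : Set} (c : A → Fin 4) x y i j → c x ≡ i → c y ≡ j →
  arrange c (allFin 4) (x ∷ y ∷ []) ≡ (if toℕ i ≤ᵇ toℕ j then x ∷ y ∷ [] else y ∷ x ∷ [])
arrange-pair c x y zero zero p q rewrite p | q = refl
arrange-pair c x y zero (suc zero) p q rewrite p | q = refl
arrange-pair c x y zero (suc (suc zero)) p q rewrite p | q = refl
arrange-pair c x y zero (suc (suc (suc zero))) p q rewrite p | q = refl
arrange-pair c x y (suc zero) zero p q rewrite p | q = refl
arrange-pair c x y (suc zero) (suc zero) p q rewrite p | q = refl
arrange-pair c x y (suc zero) (suc (suc zero)) p q rewrite p | q = refl
arrange-pair c x y (suc zero) (suc (suc (suc zero))) p q rewrite p | q = refl
arrange-pair c x y (suc (suc zero)) zero p q rewrite p | q = refl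
arrange-pair c x y (suc (suc zero)) (suc zero) p q rewrite p | q = refl
arrange-pair c x y (suc (suc zero)) (suc (suc zero)) p q rewrite p | q = refl
arrange-pair c x y (suc (suc zero)) (suc (suc (suc zero))) p q rewrite p | q = refl
arrange-pair c x y (suc (suc (suc zero))) zero p q rewrite p | q = refl
arrange-pair c x y (suc (suc (suc zero))) (suc zero) p q rewrite p | q = refl
arrange-pair c x y (suc (suc (suc zero))) (suc (suc zero)) p q rewrite p | q = refl
arrange-pair c x y (suc (suc (suc zero))) (suc (suc (suc zero))) p q rewrite p | q = refl

-- Four colours bound directed paths to three arcs, so `noShortcut` amounts to full
-- semi-transitivity of the orientation by increasing colour.
record FourColouring {V : Set} (Adj : V → V → Set) : Set where
  field
    colour : V → Fin 4
    proper : ∀ {x y} → Adj x y → colour x ≢ colour y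
  infix 4 _⇾_
  _⇾_ : V → V → Set
  x ⇾ y = Adj x y × colour x < colour y
  field
    noShortcut : ∀ {a b c d} → a ⇾ b → b ⇾ c → c ⇾ d → Adj a d → Adj a c × Adj b d

-- The representing word

module Construction {V : Set} (_≟_ : DecidableEquality V) {Adj : V → V → Set} (adj? : Decidable Adj)
  (adj-sym : ∀ {x y} → Adj x y → Adj y x) (vs : List V) (unique : Unique vs) (complete : ∀ v → v ∈ vs)
  (F : FourColouring Adj) where

  open FourColouring F
  open Restrict _≟_

  _⇾?_ : Decidable _⇾_
  x ⇾? y = adj? x y ×-dec (colour x <? colour y)

  -- Colours increase along ⇾, so no directed path has more than three arcs and ≺ is reachability.
  infix 4 _≺_
  data _≺_ (x y : V) : Set where
    one   : x ⇾ y → x ≺ y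
    two   : ∀ {p} → x ⇾ p → p ⇾ y → x ≺ y
    three : ∀ {p q} → x ⇾ p → p ⇾ q → q ⇾ y → x ≺ y

  exists? : ∀ {P : V → Set} → Decidable₁ P → Dec (∃ P)
  exists? P? = map′ Any.satisfied (λ (x , p) → lose (complete x) p) (any? P? vs)

  _≺?_ : Decidable _≺_
  x ≺? y = map′
    (λ { (inj₁ e) → one e ; (inj₂ (inj₁ (_ , e , f))) → two e f ; (inj₂ (inj₂ (_ , e , _ , f , g))) → three e f g })
    (λ { (one e) → inj₁ e ; (two e f) → inj₂ (inj₁ (_ , e , f)) ; (three e f g) → inj₂ (inj₂ (_ , e , _ , f , g)) })
    (x ⇾? y ⊎-dec exists? (λ p → x ⇾? p ×-dec p ⇾? y)
      ⊎-dec exists? (λ p → x ⇾? p ×-dec exists? (λ q → p ⇾? q ×-dec q ⇾? y)))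

  no-4-path : ∀ {a b c d e} → a ⇾ b → b ⇾ c → c ⇾ d → d ⇾ e → ⊥
  no-4-path {a} {b} {c} {d} {e} (_ , p) (_ , q) (_ , r) (_ , s) =
    ℕₚ.<⇒≱ (Finₚ.toℕ<n (colour e)) (4≤ p q r s)
    where
    4≤ : ∀ {i j k l m} → i ℕ.< j → j ℕ.< k → k ℕ.< l → l ℕ.< m → 4 ℕ.≤ m
    4≤ p q r s = ℕₚ.≤-trans (s≤s (ℕₚ.≤-trans (s≤s (ℕₚ.≤-trans (s≤s (ℕₚ.≤-trans (s≤s z≤n) p)) q)) r)) s

  ⇾-≺ : ∀ {x y z} → x ⇾ y → y ≺ z → x ≺ z
  ⇾-≺ e (one f)       = two e f
  ⇾-≺ e (two f g)     = three e f g
  ⇾-≺ e (three f g h) = ⊥-elim (no-4-path e f g h)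

  ≺-⇾ : ∀ {x y z} → x ≺ y → y ⇾ z → x ≺ z
  ≺-⇾ (one e)       f = two e f
  ≺-⇾ (two e f)     g = three e f g
  ≺-⇾ (three e f g) h = ⊥-elim (no-4-path e f g h)

  ≺⇒< : ∀ {x y} → x ≺ y → colour x < colour y
  ≺⇒< (one e)       = proj₂ e
  ≺⇒< (two e f)     = ℕₚ.<-trans (proj₂ e) (proj₂ f)
  ≺⇒< (three e f g) = ℕₚ.<-trans (proj₂ e) (ℕₚ.<-trans (proj₂ f) (proj₂ g))

  -- The paths from a to v and from v to b have at most three arcs together. If there are two, both
  -- claims are immediate; if there are three, `noShortcut` applied to the chord ab supplies the
  -- missing edge at v.
  between : ∀ {a v b} → a ⇾ b → a ≺ v → v ≺ b → (a ⇾ v) × (v ⇾ b)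
  between ab av vb = (left ab av vb , ≺⇒< av) , (right ab av vb , ≺⇒< vb)
    where
    left : ∀ {a v b} → a ⇾ b → a ≺ v → v ≺ b → Adj a v
    left ab (one e)       _               = proj₁ e
    left ab (two e f)     (one g)         = proj₁ (noShortcut e f g (proj₁ ab))
    left ab (two e f)     (two g h)       = ⊥-elim (no-4-path e f g h)
    left ab (two e f)     (three g h _)   = ⊥-elim (no-4-path e f g h)
    left ab (three e f g) (one h)         = ⊥-elim (no-4-path e f g h)
    left ab (three e f g) (two h _)       = ⊥-elim (no-4-path e f g h)
    left ab (three e f g) (three h _ _)   = ⊥-elim (no-4-path e f g h)
    right : ∀ {a v b} → a ⇾ b → a ≺ v → v ≺ b → Adj v b
    right ab _             (one g)       = proj₁ g
    right ab (one e)       (two f g)     = proj₂ (noShortcut e f g (proj₁ ab))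
    right ab (two e f)     (two g h)     = ⊥-elim (no-4-path e f g h)
    right ab (three e f g) (two h _)     = ⊥-elim (no-4-path e f g h)
    right ab (one e)       (three f g h) = ⊥-elim (no-4-path e f g h)
    right ab (two e f)     (three g h _) = ⊥-elim (no-4-path e f g h)
    right ab (three e f g) (three h _ _) = ⊥-elim (no-4-path e f g h)

  pattern anc   = zero
  pattern inn   = suc zero
  pattern other = suc (suc zero)
  pattern self  = suc (suc (suc zero))
  pattern out   = suc (suc (suc (suc zero)))
  pattern desc  = suc (suc (suc (suc (suc zero))))

  data Kind (v x : V) : Fin 6 → Set where
    isAnc   : x ≺ v → ¬ x ⇾ v → Kind v x anc
    isIn    : x ⇾ v → Kind v x inn
    isOther : ¬ x ≺ v → ¬ v ≺ x → x ≢ v → Kind v x other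
    isSelf  : x ≡ v → Kind v x self
    isOut   : v ⇾ x → Kind v x out
    isDesc  : v ≺ x → ¬ v ⇾ x → Kind v x desc

  kind : ∀ v x → ∃ (Kind v x)
  kind v x with x ≟ v | x ⇾? v | v ⇾? x | x ≺? v | v ≺? x
  ... | yes e | _     | _     | _     | _     = _ , isSelf e
  ... | no _  | yes e | _     | _     | _     = _ , isIn e
  ... | no _  | no _  | yes e | _     | _     = _ , isOut e
  ... | no _  | no ¬e | no _  | yes p | _     = _ , isAnc p ¬e
  ... | no _  | no _  | no ¬e | no _  | yes p = _ , isDesc p ¬e
  ... | no ≢  | no _  | no _  | no ¬p | no ¬q = _ , isOther ¬p ¬q ≢

  -- In the order of these slots (Halldórsson, Kitaev and Pyatkin), v alternates exactly with its
  -- neighbours, and the arcs x ⇾ y whose kinds would not alternate as x y x y are excluded by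
  -- `between` and acyclicity.
  slots : List (Fin 6)
  slots = anc ∷ inn ∷ other ∷ anc ∷ self ∷ out ∷ inn ∷ self ∷ desc ∷ other ∷ out ∷ desc ∷ []

  -- Sorting by colour is a topological order for `_⇾_`: when the ends of an arc share a bucket, the
  -- tail has to come first.
  sorted : List V
  sorted = arrange colour (allFin 4) vs

  block : V → List V → List V
  block v = arrange (proj₁ ∘ kind v) slots

  word : List V
  word = concatMap (λ v → block v sorted) vs

  restrict-word : ∀ x y → restrict _≟_ x y word ≡ concatMap (λ v → block v (restrict _≟_ x y sorted)) vs
  restrict-word x y = trans (restrict-concatMap x y (λ v → block v sorted) vs)
    (concatMap-cong (λ v → restrict-arrange x y (proj₁ ∘ kind v) slots sorted) vs)

  sorted-pair : ∀ {x y} → x ≢ y → restrict _≟_ x y sorted ≡ x ∷ y ∷ [] ⊎ restrict _≟_ x y sorted ≡ y ∷ x ∷ []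
  sorted-pair {x} {y} x≢y rewrite restrict-arrange x y colour (allFin 4) vs
    with restrict-unique x≢y unique (complete x) (complete y)
  ... | inj₁ e rewrite e | arrange-pair colour x y _ _ refl refl with toℕ (colour x) ≤ᵇ toℕ (colour y)
  ...   | true  = inj₁ refl
  ...   | false = inj₂ refl
  sorted-pair {x} {y} x≢y | inj₂ e rewrite e | arrange-pair colour y x _ _ refl refl with toℕ (colour y) ≤ᵇ toℕ (colour x)
  ...   | true  = inj₂ refl
  ...   | false = inj₁ refl

  sorted-edge : ∀ {x y} → x ⇾ y → restrict _≟_ x y sorted ≡ x ∷ y ∷ []
  sorted-edge {x} {y} (_ , x<y) rewrite restrict-arrange x y colour (allFin 4) vs
    with restrict-unique (λ { refl → ℕₚ.<-irrefl refl x<y }) unique (complete x) (complete y)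
  ... | inj₁ e rewrite e | arrange-pair colour x y _ _ refl refl
    with toℕ (colour x) ≤ᵇ toℕ (colour y) | ℕₚ.≤⇒≤ᵇ (ℕₚ.<⇒≤ x<y)
  ...   | true  | _  = refl
  sorted-edge {x} {y} (_ , x<y) | inj₂ e rewrite e | arrange-pair colour y x _ _ refl refl
    with toℕ (colour y) ≤ᵇ toℕ (colour x) | ℕₚ.≤ᵇ⇒≤ (toℕ (colour y)) (toℕ (colour x))
  ...   | true  | y≤x = ⊥-elim (ℕₚ.<⇒≱ x<y (y≤x tt))
  ...   | false | _   = refl

  block-edge : ∀ {x y} → x ⇾ y → ∀ v → block v (x ∷ y ∷ []) ≡ x ∷ y ∷ x ∷ y ∷ []
  -- The classification is generalised to a variable g with two equations, so that rewriting by them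
  -- lets `arrange` compute.
  block-edge {x} {y} xy v = go (proj₁ ∘ kind v) (proj₂ (kind v x)) (proj₂ (kind v y)) refl refl
    where
    cycle : v ≺ y → y ≺ v → ⊥
    cycle vy yv = ℕₚ.<-asym (≺⇒< vy) (≺⇒< yv)
    go : ∀ (g : V → Fin 6) {i j} → Kind v x i → Kind v y j → g x ≡ i → g y ≡ j →
      arrange g slots (x ∷ y ∷ []) ≡ x ∷ y ∷ x ∷ y ∷ []
    go g (isAnc _ _)     (isAnc _ _)     p q rewrite p | q = refl
    go g (isAnc _ _)     (isIn _)        p q rewrite p | q = refl
    go g (isAnc _ _)     (isOther _ _ _) p q rewrite p | q = refl
    go g (isAnc _ ¬xv)   (isSelf refl)   _ _ = ⊥-elim (¬xv xy)
    go g (isAnc xv ¬xv)  (isOut vy)      _ _ = ⊥-elim (¬xv (proj₁ (between xy xv (one vy))))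
    go g (isAnc xv ¬xv)  (isDesc vy _)   _ _ = ⊥-elim (¬xv (proj₁ (between xy xv vy)))
    go g (isIn xv)       (isAnc yv ¬yv)  _ _ = ⊥-elim (¬yv (proj₂ (between xv (one xy) yv)))
    go g (isIn _)        (isIn _)        p q rewrite p | q = refl
    go g (isIn _)        (isOther _ _ _) p q rewrite p | q = refl
    go g (isIn _)        (isSelf _)      p q rewrite p | q = refl
    go g (isIn _)        (isOut _)       p q rewrite p | q = refl
    go g (isIn xv)       (isDesc vy ¬vy) _ _ = ⊥-elim (¬vy (proj₂ (between xy (one xv) vy)))
    go g (isOther ¬xv _ _) (isAnc yv _)  _ _ = ⊥-elim (¬xv (⇾-≺ xy yv))
    go g (isOther ¬xv _ _) (isIn yv)     _ _ = ⊥-elim (¬xv (⇾-≺ xy (one yv)))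
    go g (isOther _ _ _) (isOther _ _ _) p q rewrite p | q = refl
    go g (isOther ¬xv _ _) (isSelf refl) _ _ = ⊥-elim (¬xv (one xy))
    go g (isOther _ _ _) (isOut _)       p q rewrite p | q = refl
    go g (isOther _ _ _) (isDesc _ _)    p q rewrite p | q = refl
    go g (isSelf refl)   (isAnc yv _)    _ _ = ⊥-elim (cycle (one xy) yv)
    go g (isSelf refl)   (isIn yv)       _ _ = ⊥-elim (cycle (one xy) (one yv))
    go g (isSelf refl)   (isOther _ ¬vy _) _ _ = ⊥-elim (¬vy (one xy))
    go g (isSelf _)      (isSelf _)      p q rewrite p | q = refl
    go g (isSelf _)      (isOut _)       p q rewrite p | q = refl
    go g (isSelf refl)   (isDesc _ ¬vy)  _ _ = ⊥-elim (¬vy xy)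
    go g (isOut vx)      (isAnc yv _)    _ _ = ⊥-elim (cycle (two vx xy) yv)
    go g (isOut vx)      (isIn yv)       _ _ = ⊥-elim (cycle (two vx xy) (one yv))
    go g (isOut vx)      (isOther _ ¬vy _) _ _ = ⊥-elim (¬vy (two vx xy))
    go g (isOut vx)      (isSelf refl)   _ _ = ⊥-elim (ℕₚ.<-asym (proj₂ vx) (proj₂ xy))
    go g (isOut _)       (isOut _)       p q rewrite p | q = refl
    go g (isOut _)       (isDesc _ _)    p q rewrite p | q = refl
    go g (isDesc vx _)   (isAnc yv _)    _ _ = ⊥-elim (cycle (≺-⇾ vx xy) yv)
    go g (isDesc vx _)   (isIn yv)       _ _ = ⊥-elim (cycle (≺-⇾ vx xy) (one yv))
    go g (isDesc vx _)   (isOther _ ¬vy _) _ _ = ⊥-elim (¬vy (≺-⇾ vx xy))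
    go g (isDesc vx _)   (isSelf refl)   _ _ = ⊥-elim (ℕₚ.<-asym (≺⇒< vx) (proj₂ xy))
    go g (isDesc vx ¬vx) (isOut vy)      _ _ = ⊥-elim (¬vx (proj₁ (between vy vx (one xy))))
    go g (isDesc _ _)    (isDesc _ _)    p q rewrite p | q = refl

  alternate-edge : ∀ {x y} → x ⇾ y → Alternate _≟_ x y word
  alternate-edge {x} {y} xy = subst (Linked _≢_) (sym (trans (restrict-word x y) (concatMap-cong same vs))) (linked vs)
    where
    x≢y : x ≢ y
    x≢y refl = ℕₚ.<-irrefl refl (proj₂ xy)
    same : ∀ v → block v (restrict _≟_ x y sorted) ≡ x ∷ y ∷ x ∷ y ∷ []
    same v = trans (cong (block v) (sorted-edge xy)) (block-edge xy v)
    linked : ∀ us → Linked _≢_ (concatMap (λ _ → x ∷ y ∷ x ∷ y ∷ []) us)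
    linked []           = []
    linked (_ ∷ [])     = x≢y ∷ (x≢y ∘ sym) ∷ x≢y ∷ [-]
    linked (_ ∷ u ∷ us) = x≢y ∷ (x≢y ∘ sym) ∷ x≢y ∷ (x≢y ∘ sym) ∷ linked (u ∷ us)

  -- The block of x breaks the alternation. Between the two `self` slots stand only `out` and `inn`,
  -- so a non-neighbour y never separates the two copies of x: the restriction is y y x x, y x x y
  -- or x x y y.
  block-nonEdge : ∀ {x y l} → x ≢ y → ¬ Adj x y → l ≡ x ∷ y ∷ [] ⊎ l ≡ y ∷ x ∷ [] → ¬ Linked _≢_ (block x l)
  block-nonEdge {x} {y} x≢y ¬xy e = go (proj₁ ∘ kind x) e (proj₂ (kind x x)) (proj₂ (kind x y)) refl refl
    where
    go : ∀ (g : V → Fin 6) {l i j} → l ≡ x ∷ y ∷ [] ⊎ l ≡ y ∷ x ∷ [] → Kind x x i → Kind x y j →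
      g x ≡ i → g y ≡ j → ¬ Linked _≢_ (arrange g slots l)
    go g _ (isAnc xx _)     _ _ _ = ⊥-elim (ℕₚ.<-irrefl refl (≺⇒< xx))
    go g _ (isIn xx)        _ _ _ = ⊥-elim (ℕₚ.<-irrefl refl (proj₂ xx))
    go g _ (isOther _ _ x≢x) _ _ _ = ⊥-elim (x≢x refl)
    go g _ (isOut xx)       _ _ _ = ⊥-elim (ℕₚ.<-irrefl refl (proj₂ xx))
    go g _ (isDesc xx _)    _ _ _ = ⊥-elim (ℕₚ.<-irrefl refl (≺⇒< xx))
    go g _ (isSelf _) (isIn yx)     _ _ = ⊥-elim (¬xy (adj-sym (proj₁ yx)))
    go g _ (isSelf _) (isOut xy)    _ _ = ⊥-elim (¬xy (proj₁ xy))
    go g _ (isSelf _) (isSelf y≡x)  _ _ = ⊥-elim (x≢y (sym y≡x))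
    go g (inj₁ refl) (isSelf _) (isAnc _ _)     p q rewrite p | q = λ { (≢ ∷ _) → ≢ refl }
    go g (inj₂ refl) (isSelf _) (isAnc _ _)     p q rewrite q | p = λ { (≢ ∷ _) → ≢ refl }
    go g (inj₁ refl) (isSelf _) (isOther _ _ _) p q rewrite p | q = λ { (_ ∷ ≢ ∷ _) → ≢ refl }
    go g (inj₂ refl) (isSelf _) (isOther _ _ _) p q rewrite q | p = λ { (_ ∷ ≢ ∷ _) → ≢ refl }
    go g (inj₁ refl) (isSelf _) (isDesc _ _)    p q rewrite p | q = λ { (≢ ∷ _) → ≢ refl }
    go g (inj₂ refl) (isSelf _) (isDesc _ _)    p q rewrite q | p = λ { (≢ ∷ _) → ≢ refl }

  alternate⇒adj : ∀ {x y} → x ≢ y → Alternate _≟_ x y word → Adj x y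
  alternate⇒adj {x} {y} x≢y alt = decidable-stable (adj? x y) λ ¬xy → block-nonEdge x≢y ¬xy (sorted-pair x≢y)
    (Linked-concatMap⁻ (complete x) (subst (Linked _≢_) (restrict-word x y) alt))

  adj⇒alternate : ∀ {x y} → Adj x y → Alternate _≟_ x y word
  adj⇒alternate {x} {y} xy = go (Finₚ.<-cmp (colour x) (colour y))
    where
    go : Tri (colour x < colour y) (colour x ≡ colour y) (colour y < colour x) → Alternate _≟_ x y word
    go (tri< x<y _ _) = alternate-edge (xy , x<y)
    go (tri≈ _ x≡y _) = ⊥-elim (proper xy x≡y)
    go (tri> _ _ y<x) = subst (Linked _≢_) (restrict-comm _≟_ y x word) (alternate-edge (adj-sym xy , y<x))

  ∈-arrange : ∀ {m} (h : V → Fin m) {ks l v} → v ∈ l → h v ∈ ks → v ∈ arrange h ks l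
  ∈-arrange h p q = ∈-concatMap⁺ _ (Any.map (λ {k} → ∈-filter⁺ (λ x → h x Finₚ.≟ k) p) q)

  ∈-slots : ∀ k → k ∈ slots
  ∈-slots anc   = here refl
  ∈-slots inn   = there (here refl)
  ∈-slots other = there (there (here refl))
  ∈-slots self  = there (there (there (there (here refl))))
  ∈-slots out   = there (there (there (there (there (here refl)))))
  ∈-slots desc  = there (there (there (there (there (there (there (there (here refl))))))))

  representable : WordRepresentable V _≟_ Adj
  representable = word
    , (λ v → ∈-concatMap⁺ _ (lose (complete v)
        (∈-arrange (proj₁ ∘ kind v) (∈-arrange colour (complete v) (∈-allFin (colour v))) (∈-slots _))))
    , (λ x y x≢y → mk⇔ (alternate⇒adj x≢y) adj⇒alternate)

-- The triangulated cylinder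

Layer : Set
Layer = Vec Bool 3

-- The first index is the column in the lower-numbered row, the second the column in the next row.
-- With three sectors, two distinct columns always bound exactly one cell, whose bit or negated bit
-- decides the entry.
rung : Layer → Fin 3 → Fin 3 → Bool
rung (p ∷ q ∷ r ∷ []) zero             zero             = true
rung (p ∷ q ∷ r ∷ []) zero             (suc zero)       = p
rung (p ∷ q ∷ r ∷ []) zero             (suc (suc zero)) = not r
rung (p ∷ q ∷ r ∷ []) (suc zero)       zero             = not p
rung (p ∷ q ∷ r ∷ []) (suc zero)       (suc zero)       = true
rung (p ∷ q ∷ r ∷ []) (suc zero)       (suc (suc zero)) = q
rung (p ∷ q ∷ r ∷ []) (suc (suc zero)) zero             = r
rung (p ∷ q ∷ r ∷ []) (suc (suc zero)) (suc zero)       = not q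
rung (p ∷ q ∷ r ∷ []) (suc (suc zero)) (suc (suc zero)) = true

adj : (ℕ → Layer) → ℕ → Fin 3 → ℕ → Fin 3 → Bool
adj u zero          a zero          b = not (does (a Finₚ.≟ b))
adj u zero          a (suc zero)    b = rung (u 0) a b
adj u zero          a (suc (suc _)) b = false
adj u (suc i)       a (suc k)       b = adj (u ∘ suc) i a k b
adj u (suc zero)    a zero          b = rung (u 0) b a
adj u (suc (suc _)) a zero          b = false

-- The last layer is repeated forever, so that the rows may be indexed by ℕ.
layers : ∀ {n} → Triangulation (suc n) → ℕ → Layer
layers         t zero    = tabulate (t zero)
layers {zero}  t (suc i) = tabulate (t zero)
layers {suc n} t (suc i) = layers (t ∘ suc) i

Vertex : Set
Vertex = ℕ × Fin 3

⌊_⌋ : ∀ {m} → Fin m × Fin 3 → Vertex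
⌊ i , a ⌋ = toℕ i , a

Edge : (ℕ → Layer) → Vertex → Vertex → Set
Edge u (i , a) (k , b) = adj u i a k b ≡ true

triEdge⇒edge : ∀ {n} (t : Triangulation (suc n)) {x y} → TriEdge t x y → Edge (layers t) ⌊ x ⌋ ⌊ y ⌋
triEdge⇒edge t (horiz i j) = go (layers t) (toℕ i) j
  where
  go : ∀ u i j → adj u i j i (next3 j) ≡ true
  go u zero    zero             = refl
  go u zero    (suc zero)       = refl
  go u zero    (suc (suc zero)) = refl
  go u (suc i) j                = go (u ∘ suc) i j
triEdge⇒edge         t (vert zero zero)                         = refl
triEdge⇒edge         t (vert zero (suc zero))                   = refl
triEdge⇒edge         t (vert zero (suc (suc zero)))             = refl
triEdge⇒edge {suc _} t (vert (suc i) j)                         = triEdge⇒edge (t ∘ suc) (vert i j)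
triEdge⇒edge         t (diag₁ zero zero e)                      = e
triEdge⇒edge         t (diag₁ zero (suc zero) e)                = e
triEdge⇒edge         t (diag₁ zero (suc (suc zero)) e)          = e
triEdge⇒edge {suc _} t (diag₁ (suc i) j e)                      = triEdge⇒edge (t ∘ suc) (diag₁ i j e)
triEdge⇒edge         t (diag₂ zero zero e)                      = cong not e
triEdge⇒edge         t (diag₂ zero (suc zero) e)                = cong not e
triEdge⇒edge         t (diag₂ zero (suc (suc zero)) e)          = cong not e
triEdge⇒edge {suc _} t (diag₂ (suc i) j e)                      = triEdge⇒edge (t ∘ suc) (diag₂ i j e)

adj-sym : ∀ u i a k b → adj u i a k b ≡ true → adj u k b i a ≡ true
adj-sym u zero          a zero          b e with a Finₚ.≟ b | b Finₚ.≟ a | e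
... | no a≢b | yes refl | _ = ⊥-elim (a≢b refl)
... | no _   | no _     | _ = refl
adj-sym u zero          a (suc zero)    b e = e
adj-sym u (suc zero)    a zero          b e = e
adj-sym u (suc i)       a (suc k)       b e = adj-sym (u ∘ suc) i a k b e

triAdj⇒edge : ∀ {n} (t : Triangulation (suc n)) x y → TriAdj t x y → Edge (layers t) ⌊ x ⌋ ⌊ y ⌋
triAdj⇒edge t x y (inj₁ e) = triEdge⇒edge t e
triAdj⇒edge t x@(i , a) y@(k , b) (inj₂ e) = adj-sym (layers t) (toℕ k) b (toℕ i) a (triEdge⇒edge t e)

not≡true : ∀ {b} → not b ≡ true → b ≡ false
not≡true {false} _ = refl

same-row : ∀ {n} (t : Triangulation n) i a b → not (does (a Finₚ.≟ b)) ≡ true → TriAdj t (i , a) (i , b)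
same-row t i zero             (suc zero)       _ = inj₁ (horiz i _)
same-row t i (suc zero)       (suc (suc zero)) _ = inj₁ (horiz i _)
same-row t i (suc (suc zero)) zero             _ = inj₁ (horiz i _)
same-row t i (suc zero)       zero             _ = inj₂ (horiz i _)
same-row t i (suc (suc zero)) (suc zero)       _ = inj₂ (horiz i _)
same-row t i zero             (suc (suc zero)) _ = inj₂ (horiz i _)
same-row t i (suc (suc zero)) (suc (suc zero)) ()

edge⇒triAdj : ∀ {n} (t : Triangulation (suc n)) x y → Edge (layers t) ⌊ x ⌋ ⌊ y ⌋ → TriAdj t x y
edge⇒triAdj t (zero , a) (zero , b) e = same-row t zero a b e
edge⇒triAdj t (zero , a) (suc zero , b) e = next-row a b e
  where
  next-row : ∀ a b → rung (tabulate (t zero)) a b ≡ true → TriAdj t (zero , a) (suc zero , b)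
  next-row zero             zero             _ = inj₁ (vert zero _)
  next-row (suc zero)       (suc zero)       _ = inj₁ (vert zero _)
  next-row (suc (suc zero)) (suc (suc zero)) _ = inj₁ (vert zero _)
  next-row zero             (suc zero)       e = inj₁ (diag₁ zero _ e)
  next-row (suc zero)       (suc (suc zero)) e = inj₁ (diag₁ zero _ e)
  next-row (suc (suc zero)) zero             e = inj₁ (diag₁ zero _ e)
  next-row (suc zero)       zero             e = inj₂ (diag₂ zero _ (not≡true e))
  next-row (suc (suc zero)) (suc zero)       e = inj₂ (diag₂ zero _ (not≡true e))
  next-row zero             (suc (suc zero)) e = inj₂ (diag₂ zero _ (not≡true e))
edge⇒triAdj t (suc zero , a) (zero , b) e = Sum.swap (edge⇒triAdj t (zero , b) (suc zero , a) e)
edge⇒triAdj {zero}  t (suc zero , a) (suc zero , b) e = same-row t (suc zero) a b e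
edge⇒triAdj {suc n} t (suc i , a) (suc k , b) e = Sum.map lift lift (edge⇒triAdj (t ∘ suc) (i , a) (k , b) e)
  where
  lift : ∀ {i a k b} → TriEdge (t ∘ suc) (i , a) (k , b) → TriEdge t (suc i , a) (suc k , b)
  lift (horiz i j)   = horiz (suc i) j
  lift (vert i j)    = vert (suc i) j
  lift (diag₁ i j e) = diag₁ (suc i) j e
  lift (diag₂ i j e) = diag₂ (suc i) j e

-- Colouring a chain of layers

Compatible : Layer → Layer → Set
Compatible p q = q ≡ p ⊎ q ≡ Vec.map not p

Chain : (ℕ → Layer) → Set
Chain u = ∀ i → Compatible (u i) (u (suc i))

-- If the three diagonals of a layer are parallel, the rows are 3-coloured cyclically. Otherwise
-- v_{i,a} and v_{i+1,b} are adjacent iff position a ≤ position b (majority true) or iff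
-- position a ≥ position b (majority false), and the 4-colouring, unique up to renaming, is
-- h_i + position a modulo 4, where h_{i+1} = h_i ± 1 according to the majority.
residue : Layer → ℕ → Fin 4
residue (true  ∷ true  ∷ true  ∷ []) i = inject₁ (i mod 3)
residue (false ∷ false ∷ false ∷ []) i = inject₁ (i mod 3)
residue _                            i = i mod 4

position : Layer → Fin 3 → ℕ
position (true  ∷ false ∷ false ∷ []) j = lookup (2 ∷ 0 ∷ 1 ∷ []) j
position (false ∷ true  ∷ true  ∷ []) j = lookup (2 ∷ 0 ∷ 1 ∷ []) j
position (true  ∷ false ∷ true  ∷ []) j = lookup (1 ∷ 2 ∷ 0 ∷ []) j
position (false ∷ true  ∷ false ∷ []) j = lookup (1 ∷ 2 ∷ 0 ∷ []) j
position _                            j = toℕ j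

majority : Layer → Bool
majority (p ∷ q ∷ r ∷ []) = if p then q ∨ r else q ∧ r

-- 11 stands for −1, modulo 3 and modulo 4 alike.
step : Layer → Fin 4 → Fin 4
step p h = residue p (toℕ h + (if majority p then 1 else 11))

-- A layer and its complement have the same `residue` and `position`, so along a chain these never
-- change from row to row; only the offset h does.
colourAt : (ℕ → Layer) → Fin 4 → ℕ → Fin 3 → Fin 4
colourAt u h zero    j = residue (u 0) (toℕ h + position (u 0) j)
colourAt u h (suc i) j = colourAt (u ∘ suc) (step (u 0) h) i j

-- Verification of the colouring on three consecutive rows

edge? : ∀ u → Decidable (Edge u)
edge? u (i , a) (k , b) = adj u i a k b Boolₚ.≟ true

Arc : (ℕ → Layer) → Fin 4 → Vertex → Vertex → Set
Arc u h (i , a) (k , b) = Edge u (i , a) (k , b) × colourAt u h i a < colourAt u h k b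

arc? : ∀ u h → Decidable (Arc u h)
arc? u h (i , a) (k , b) = edge? u (i , a) (k , b) ×-dec (colourAt u h i a <? colourAt u h k b)

NoShortcut : (u : ℕ → Layer) → Fin 4 → Vertex → Vertex → Vertex → Vertex → Set
NoShortcut u h a b c d = Arc u h a b → Arc u h b c → Arc u h c d → Edge u a d → Edge u a c × Edge u b d

Proper : (u : ℕ → Layer) → Fin 4 → Vertex → Vertex → Set
Proper u h (i , a) (k , b) = Edge u (i , a) (k , b) → colourAt u h i a ≢ colourAt u h k b

-- Three rows enclose two layers of cells, but the colours of row 2 are computed from the third
-- layer.
pad : Layer → Layer → Layer → ℕ → Layer
pad p q r zero          = p
pad p q r (suc zero)    = q
pad p q r (suc (suc _)) = r

flip : Bool → Layer → Layer
flip b = if b then Vec.map not else id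

∀Bool? : ∀ {P : Bool → Set} → (∀ b → Dec (P b)) → Dec (∀ b → P b)
∀Bool? P? = map′ (λ { (f , t) false → f ; (f , t) true → t }) (λ f → f false , f true) (P? false ×-dec P? true)

∀Layer? : ∀ {P : Layer → Set} → (∀ p → Dec (P p)) → Dec (∀ p → P p)
∀Layer? P? = map′ (λ { f (x ∷ y ∷ z ∷ []) → f x y z }) (λ f x y z → f (x ∷ y ∷ z ∷ []))
  (∀Bool? λ x → ∀Bool? λ y → ∀Bool? λ z → P? (x ∷ y ∷ z ∷ []))

WindowVertex : Set
WindowVertex = Fin 3 × Fin 3

∀Window? : ∀ {P : WindowVertex → Set} → (∀ x → Dec (P x)) → Dec (∀ x → P x)
∀Window? P? = map′ (λ f (i , a) → f i a) (λ f i a → f (i , a)) (Finₚ.all? λ i → Finₚ.all? λ a → P? (i , a))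

-- Three consecutive rows suffice because a, b, c, d form a closed walk of length four. Each arc is
-- tested before the next vertex is quantified, which keeps the evaluation short.
Window : (u : ℕ → Layer) → Fin 4 → Set
Window u h = ∀ (a b : WindowVertex) → Proper u h ⌊ a ⌋ ⌊ b ⌋ ×
  (Arc u h ⌊ a ⌋ ⌊ b ⌋ → ∀ (c : WindowVertex) → Arc u h ⌊ b ⌋ ⌊ c ⌋ → ∀ (d : WindowVertex) → Arc u h ⌊ c ⌋ ⌊ d ⌋ →
    Edge u ⌊ a ⌋ ⌊ d ⌋ → Edge u ⌊ a ⌋ ⌊ c ⌋ × Edge u ⌊ b ⌋ ⌊ d ⌋)

window? : ∀ u h → Dec (Window u h)
window? u h = ∀Window? λ a → ∀Window? λ b →
  (edge? u ⌊ a ⌋ ⌊ b ⌋ →-dec ¬? (_ Finₚ.≟ _)) ×-dec (arc? u h ⌊ a ⌋ ⌊ b ⌋ →-dec ∀Window? λ c → arc? u h ⌊ b ⌋ ⌊ c ⌋ →-dec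
    ∀Window? λ d → arc? u h ⌊ c ⌋ ⌊ d ⌋ →-dec (edge? u ⌊ a ⌋ ⌊ d ⌋ →-dec (edge? u ⌊ a ⌋ ⌊ c ⌋ ×-dec edge? u ⌊ b ⌋ ⌊ d ⌋)))

-- In a chain, a window is determined by its first layer, two choices of complementing and the
-- offset, which leaves 128 cases.
windows? : Dec (∀ p b c h → Window (pad p (flip b p) (flip c (flip b p))) h)
windows? = ∀Layer? λ p → ∀Bool? λ b → ∀Bool? λ c → Finₚ.all? λ h → window? _ h

windows : ∀ p b c h → Window (pad p (flip b p) (flip c (flip b p))) h
windows = witness windows? refl

adj-pad : ∀ u r (x y : WindowVertex) → let (i , a) = x ; (k , b) = y in
  adj u (toℕ i) a (toℕ k) b ≡ adj (pad (u 0) (u 1) r) (toℕ i) a (toℕ k) b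
adj-pad u r (zero , _)           (zero , _)           = refl
adj-pad u r (zero , _)           (suc zero , _)       = refl
adj-pad u r (zero , _)           (suc (suc zero) , _) = refl
adj-pad u r (suc zero , _)       (zero , _)           = refl
adj-pad u r (suc zero , _)       (suc zero , _)       = refl
adj-pad u r (suc zero , _)       (suc (suc zero) , _) = refl
adj-pad u r (suc (suc zero) , _) (zero , _)           = refl
adj-pad u r (suc (suc zero) , _) (suc zero , _)       = refl
adj-pad u r (suc (suc zero) , _) (suc (suc zero) , _) = refl

colour-pad : ∀ u h (i : Fin 3) a → colourAt u h (toℕ i) a ≡ colourAt (pad (u 0) (u 1) (u 2)) h (toℕ i) a
colour-pad u h zero             a = refl
colour-pad u h (suc zero)       a = refl
colour-pad u h (suc (suc zero)) a = refl

compatible⇒flip : ∀ {p q} → Compatible p q → ∃ λ b → q ≡ flip b p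
compatible⇒flip (inj₁ e) = false , e
compatible⇒flip (inj₂ e) = true , e

module _ (u : ℕ → Layer) (chain : Chain u) (h : Fin 4) where

  private
    v : ℕ → Layer
    v = pad (u 0) (u 1) (u 2)

    edge⇒ : ∀ (x y : WindowVertex) → Edge u ⌊ x ⌋ ⌊ y ⌋ → Edge v ⌊ x ⌋ ⌊ y ⌋
    edge⇒ x y = trans (sym (adj-pad u (u 2) x y))

    edge⇐ : ∀ (x y : WindowVertex) → Edge v ⌊ x ⌋ ⌊ y ⌋ → Edge u ⌊ x ⌋ ⌊ y ⌋
    edge⇐ x y = trans (adj-pad u (u 2) x y)

    arc⇒ : ∀ (x y : WindowVertex) → Arc u h ⌊ x ⌋ ⌊ y ⌋ → Arc v h ⌊ x ⌋ ⌊ y ⌋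
    arc⇒ x y (e , lt) = edge⇒ x y e , subst₂ _<_ (colour-pad u h (proj₁ x) (proj₂ x)) (colour-pad u h (proj₁ y) (proj₂ y)) lt

    window-v : Window v h
    window-v with compatible⇒flip (chain 0) | compatible⇒flip (chain 1)
    ... | b , e | c , f rewrite f | e = windows (u 0) b c h

  window-proper : ∀ (x y : WindowVertex) → Proper u h ⌊ x ⌋ ⌊ y ⌋
  window-proper x y e same = proj₁ (window-v x y) (edge⇒ x y e)
    (trans (sym (colour-pad u h (proj₁ x) (proj₂ x))) (trans same (colour-pad u h (proj₁ y) (proj₂ y))))

  window-noShortcut : ∀ (a b c d : WindowVertex) → NoShortcut u h ⌊ a ⌋ ⌊ b ⌋ ⌊ c ⌋ ⌊ d ⌋
  window-noShortcut a b c d ab bc cd ad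
    with (ac , bd) ← proj₂ (window-v a b) (arc⇒ a b ab) c (arc⇒ b c bc) d (arc⇒ c d cd) (edge⇒ a d ad)
    = edge⇐ a c ac , edge⇐ b d bd

near : ∀ u i a k b → adj u i a k b ≡ true → k ≤ suc i
near u i             a zero       b e = z≤n
near u zero          a (suc zero) b e = s≤s z≤n
near u (suc i)       a (suc k)    b e = s≤s (near (u ∘ suc) i a k b e)

near′ : ∀ u i a k b → adj u i a k b ≡ true → i ≤ suc k
near′ u i a k b e = near u k b i a (adj-sym u i a k b e)

≤1⇒≤2 : ∀ {i} → i ≤ 1 → i ≤ 2
≤1⇒≤2 = ℕₚ.m≤n⇒m≤1+n

lowRow : ∀ {i} → i ≤ 2 → ∃ λ (r : Fin 3) → toℕ r ≡ i
lowRow i≤2 = fromℕ< (s≤s i≤2) , Finₚ.toℕ-fromℕ< (s≤s i≤2)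

proper-low : ∀ u → Chain u → ∀ h {i k} a b → i ≤ 2 → k ≤ 2 → Proper u h (i , a) (k , b)
proper-low u ch h a b p q with i , refl ← lowRow p | k , refl ← lowRow q = window-proper u ch h (i , a) (k , b)

-- Dropping row 0 replaces the offset by its `step`. This is repeated until one end lies in row 0;
-- the other is then in row 0 or 1.
proper-at : ∀ u → Chain u → ∀ h x y → Proper u h x y
proper-at u ch h (suc i , a) (suc k , b)   = proper-at (u ∘ suc) (ch ∘ suc) (step (u 0) h) (i , a) (k , b)
proper-at u ch h (zero , a)  (k , b)     e = proper-low u ch h a b z≤n (≤1⇒≤2 (near u 0 a k b e)) e
proper-at u ch h (suc i , a) (zero , b)  e = proper-low u ch h a b (≤1⇒≤2 (near′ u (suc i) a 0 b e)) z≤n e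

noShortcut-low : ∀ u → Chain u → ∀ h {i k l m} a b c d → i ≤ 2 → k ≤ 2 → l ≤ 2 → m ≤ 2 →
  NoShortcut u h (i , a) (k , b) (l , c) (m , d)
noShortcut-low u ch h a b c d p q r s
  with i , refl ← lowRow p | k , refl ← lowRow q | l , refl ← lowRow r | m , refl ← lowRow s
  = window-noShortcut u ch h (i , a) (k , b) (l , c) (m , d)

-- Rows are dropped until one of the four vertices lies in row 0. Its two neighbours on the closed
-- walk a b c d are then in rows up to 1 and the opposite vertex in rows up to 2, so the window
-- applies.
noShortcut-at : ∀ u → Chain u → ∀ h a b c d → NoShortcut u h a b c d
noShortcut-at u ch h (suc i , a) (suc k , b) (suc l , c) (suc m , d) =
  noShortcut-at (u ∘ suc) (ch ∘ suc) (step (u 0) h) (i , a) (k , b) (l , c) (m , d)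
noShortcut-at u ch h (zero , a) (k , b) (l , c) (m , d) ab bc cd ad =
  noShortcut-low u ch h a b c d
    z≤n (≤1⇒≤2 k≤1) (ℕₚ.≤-trans (near u k b l c (proj₁ bc)) (s≤s k≤1)) (≤1⇒≤2 (near u 0 a m d ad))
    ab bc cd ad
  where k≤1 = near u 0 a k b (proj₁ ab)
noShortcut-at u ch h (i@(suc _) , a) (zero , b) (l , c) (m , d) ab bc cd ad =
  noShortcut-low u ch h a b c d
    (≤1⇒≤2 (near′ u i a 0 b (proj₁ ab))) z≤n (≤1⇒≤2 l≤1) (ℕₚ.≤-trans (near u l c m d (proj₁ cd)) (s≤s l≤1))
    ab bc cd ad
  where l≤1 = near u 0 b l c (proj₁ bc)
noShortcut-at u ch h (i@(suc _) , a) (k@(suc _) , b) (zero , c) (m , d) ab bc cd ad =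
  noShortcut-low u ch h a b c d
    (ℕₚ.≤-trans (near′ u i a k b (proj₁ ab)) (s≤s k≤1)) (≤1⇒≤2 k≤1) z≤n (≤1⇒≤2 (near u 0 c m d (proj₁ cd)))
    ab bc cd ad
  where k≤1 = near′ u k b 0 c (proj₁ bc)
noShortcut-at u ch h (i@(suc _) , a) (k@(suc _) , b) (l@(suc _) , c) (zero , d) ab bc cd ad =
  noShortcut-low u ch h a b c d
    (≤1⇒≤2 (near′ u i a 0 d ad)) (ℕₚ.≤-trans (near′ u k b l c (proj₁ bc)) (s≤s l≤1)) (≤1⇒≤2 l≤1) z≤n
    ab bc cd ad
  where l≤1 = near′ u l c 0 d (proj₁ cd)

fourColouring : ∀ {n} (t : Triangulation (suc n)) → Chain (layers t) → FourColouring (TriAdj t)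
fourColouring t ch = record
  { colour     = λ (i , a) → colourAt (layers t) zero (toℕ i) a
  ; proper     = λ {x} {y} xy → proper-at (layers t) ch zero ⌊ x ⌋ ⌊ y ⌋ (triAdj⇒edge t x y xy)
  ; noShortcut = λ {a} {b} {c} {d} (ab , p) (bc , q) (cd , r) ad →
      let (ac , bd) = noShortcut-at (layers t) ch zero ⌊ a ⌋ ⌊ b ⌋ ⌊ c ⌋ ⌊ d ⌋
                        (triAdj⇒edge t a b ab , p) (triAdj⇒edge t b c bc , q) (triAdj⇒edge t c d cd , r)
                        (triAdj⇒edge t a d ad)
      in edge⇒triAdj t a c ac , edge⇒triAdj t b d bd
  }

triAdj? : ∀ {n} (t : Triangulation (suc n)) → Decidable (TriAdj t)
triAdj? t x y = map′ (edge⇒triAdj t x y) (triAdj⇒edge t x y) (_ Boolₚ.≟ true)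

chain⇒representable : ∀ {n} (t : Triangulation (suc n)) → Chain (layers t) →
  WordRepresentable (CylV (suc n)) (cylV-≟ (suc n)) (TriAdj t)
chain⇒representable {n} t ch = Construction.representable (cylV-≟ (suc n)) (triAdj? t) Sum.swap
  (cartesianProduct (allFin _) (allFin _)) (Unique.cartesianProduct⁺ (Unique.allFin⁺ _) (Unique.allFin⁺ _))
  (λ (i , a) → ∈-cartesianProduct⁺ (∈-allFin i) (∈-allFin a)) (fourColouring t ch)

-- Obstructions in two consecutive layers

_≟ʷ_ : DecidableEquality WindowVertex
_≟ʷ_ = ≡-dec Finₚ._≟_ Finₚ._≟_

windowVertices : List WindowVertex
windowVertices = cartesianProduct (allFin 3) (allFin 3)

adjʷ : Layer → Layer → WindowVertex → WindowVertex → Bool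
adjʷ p q (i , a) (k , b) = adj (pad p q q) (toℕ i) a (toℕ k) b

module _ (p q : Layer) (k : ℕ) (es : List (ℕ × ℕ)) where

  -- Stated as equalities of Booleans so that it is decided by evaluation; the first component
  -- yields injectivity.
  Embedding : Vec WindowVertex k → Set
  Embedding f = ∀ a b → (does (a Finₚ.≟ b) ≡ does (lookup f a ≟ʷ lookup f b))
                      × (does (edgeListAdj? k es a b) ≡ adjʷ p q (lookup f a) (lookup f b))

  embedding? : ∀ f → Dec (Embedding f)
  embedding? f = Finₚ.all? λ a → Finₚ.all? λ b → (_ Boolₚ.≟ _) ×-dec (_ Boolₚ.≟ _)

  -- Here x is the proposed image of label l, and the vector lists the images of m, m + 1, .... As l
  -- < m and the edge lists put the smaller label first, only (l , m) has to be looked up.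
  fits : ℕ → WindowVertex → ∀ {j} → ℕ → Vec WindowVertex j → Bool
  fits l x m []      = true
  fits l x m (y ∷ f) = not (does (x ≟ʷ y)) ∧ does (does ((l , m) ∈? es) Boolₚ.≟ adjʷ p q x y) ∧ fits l x (suc m) f
    where open DecMembership (≡-dec ℕₚ._≟_ ℕₚ._≟_) using (_∈?_)

  -- Labels are placed in decreasing order, so that f lists the images of l , l + 1 , ….
  partials : ℕ → (j : ℕ) → List (Vec WindowVertex j)
  partials l zero    = [] ∷ []
  partials l (suc j) = concatMap (λ f → map (_∷ f) (filterᵇ (λ x → fits l x (suc l) f) windowVertices)) (partials (suc l) j)

  -- Each candidate is checked again by `embedding?`, so soundness does not rest on the pruning in
  -- `partials`.
  search : Maybe (∃ Embedding)
  search = first (partials 1 k)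
    where
    first : List (Vec WindowVertex k) → Maybe (∃ Embedding)
    first []       = nothing
    first (f ∷ fs) with embedding? f
    ... | yes e = just (f , e)
    ... | no _  = first fs

Obstructed : Layer → Layer → Set
Obstructed p q = ∃ (Embedding p q 7 H₁-edges) ⊎ ∃ (Embedding p q 8 H₄-edges) ⊎ ∃ (Embedding p q 8 H₅-edges)

classify : ∀ p q → Maybe (Compatible p q ⊎ Obstructed p q)
classify p q with Vec.≡-dec Boolₚ._≟_ q p | Vec.≡-dec Boolₚ._≟_ q (Vec.map not p)
... | yes e | _     = just (inj₁ (inj₁ e))
... | no _  | yes e = just (inj₁ (inj₂ e))
... | no _  | no _  = Maybe.map inj₂ (Maybe.map inj₁ (search p q 7 H₁-edges) <∣>
  (Maybe.map (inj₂ ∘ inj₁) (search p q 8 H₄-edges) <∣> Maybe.map (inj₂ ∘ inj₂) (search p q 8 H₅-edges)))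

-- All 64 pairs of layers are run through `classify`: each is compatible or contains one of the
-- three obstructions.
classified? : Dec (∀ p q → is-just (classify p q) ≡ true)
classified? = ∀Layer? λ p → ∀Layer? λ q → _ Boolₚ.≟ true

classified : ∀ p q → is-just (classify p q) ≡ true
classified = witness classified? refl

fromJust : ∀ {A : Set} (m : Maybe A) → is-just m ≡ true → A
fromJust (just x) _ = x

compatible-or-obstructed : ∀ p q → Compatible p q ⊎ Obstructed p q
compatible-or-obstructed p q = fromJust (classify p q) (classified p q)

embedding⇒contains : ∀ {n} (t : Triangulation (suc (suc n))) k es →
  ∃ (Embedding (tabulate (t zero)) (tabulate (t (suc zero))) k es) → TContains t k es
embedding⇒contains {n} t k es (f , e) = place ∘ lookup f , inj , λ a b _ → mk⇔ (to a b) (from a b)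
  where
  q = tabulate (t (suc zero))
  place : WindowVertex → CylV (suc (suc n))
  place (i , a) = i ↑ˡ n , a

  place-injective : ∀ {x y} → place x ≡ place y → x ≡ y
  place-injective eq = cong₂ _,_ (Finₚ.↑ˡ-injective n _ _ (,-injectiveˡ eq)) (,-injectiveʳ eq)

  inj : ∀ {a b} → place (lookup f a) ≡ place (lookup f b) → a ≡ b
  inj {a} {b} eq = witness (a Finₚ.≟ b) (trans (proj₁ (e a b)) (dec-true (_ ≟ʷ _) (place-injective eq)))

  adj-place : ∀ x y → adj (layers t) (toℕ (proj₁ x ↑ˡ n)) (proj₂ x) (toℕ (proj₁ y ↑ˡ n)) (proj₂ y)
    ≡ adjʷ (tabulate (t zero)) q x y
  adj-place x@(i , _) y@(k , _) rewrite Finₚ.toℕ-↑ˡ i n | Finₚ.toℕ-↑ˡ k n = adj-pad (layers t) q x y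

  to : ∀ a b → EdgeListAdj k es a b → TriAdj t (place (lookup f a)) (place (lookup f b))
  to a b ab = edge⇒triAdj t _ _ (trans (adj-place (lookup f a) (lookup f b))
    (trans (sym (proj₂ (e a b))) (dec-true (edgeListAdj? k es a b) ab)))

  from : ∀ a b → TriAdj t (place (lookup f a)) (place (lookup f b)) → EdgeListAdj k es a b
  from a b fab = witness (edgeListAdj? k es a b) (trans (proj₂ (e a b))
    (trans (sym (adj-place (lookup f a) (lookup f b))) (triAdj⇒edge t _ _ fab)))

shift-contains : ∀ {n} (t : Triangulation (suc (suc n))) k es → TContains (t ∘ suc) k es → TContains t k es
shift-contains {n} t k es (f , inj , iso) = shift ∘ f , inj ∘ shift-injective , λ a b a≢b → mk⇔
    (λ ab → edge⇒triAdj t (shift (f a)) (shift (f b)) (triAdj⇒edge (t ∘ suc) (f a) (f b) (Equivalence.to (iso a b a≢b) ab)))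
    (λ ab → Equivalence.from (iso a b a≢b)
      (edge⇒triAdj (t ∘ suc) (f a) (f b) (triAdj⇒edge t (shift (f a)) (shift (f b)) ab)))
  where
  shift : CylV (suc n) → CylV (suc (suc n))
  shift (i , a) = suc i , a

  shift-injective : ∀ {x y} → shift x ≡ shift y → x ≡ y
  shift-injective refl = refl

free⇒chain : ∀ {n} (t : Triangulation (suc n)) →
  ¬ TContains t 7 H₁-edges → ¬ TContains t 8 H₄-edges → ¬ TContains t 8 H₅-edges → Chain (layers t)
-- A single layer remains, and its repetitions agree with it.
free⇒chain {zero}  t _  _  _  zero    = inj₁ refl
free⇒chain {zero}  t _  _  _  (suc i) = inj₁ refl
free⇒chain {suc n} t h₁ h₄ h₅ (suc i) = free⇒chain (t ∘ suc)
  (h₁ ∘ shift-contains t 7 _) (h₄ ∘ shift-contains t 8 _) (h₅ ∘ shift-contains t 8 _) i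
free⇒chain {suc n} t h₁ h₄ h₅ zero    = Sum.fromInj₁ (⊥-elim ∘ unobstructed)
  (compatible-or-obstructed (tabulate (t zero)) (tabulate (t (suc zero))))
  where
  unobstructed : ¬ Obstructed (tabulate (t zero)) (tabulate (t (suc zero)))
  unobstructed (inj₁ e)        = h₁ (embedding⇒contains t 7 _ e)
  unobstructed (inj₂ (inj₁ e)) = h₄ (embedding⇒contains t 8 _ e)
  unobstructed (inj₂ (inj₂ e)) = h₅ (embedding⇒contains t 8 _ e)

-- The equivalence

representable⇒free : ∀ {n} (t : Triangulation n) k es → ¬ SemiTransitive (EdgeListAdj k es) →
  WordRepresentable (CylV n) (cylV-≟ n) (TriAdj t) → ¬ TContains t k es
representable⇒free {n} t k es nst wr (f , inj , iso) =
  nst (pullback f inj iso (Occurrences.representable⇒semiTransitive (cylV-≟ n) wr))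

theorem6 : (n : ℕ) → n ≥ 1 → (t : Triangulation n) →
    WordRepresentable (CylV n) (cylV-≟ n) (TriAdj t)
    ⇔ (¬ TContains t 7 H₁-edges × ¬ TContains t 7 H₂-edges × ¬ TContains t 8 H₃-edges
    × ¬ TContains t 8 H₄-edges × ¬ TContains t 8 H₅-edges × ¬ TContains t 8 H₆-edges)
theorem6 (suc n) _ t = mk⇔
  (λ wr → representable⇒free t 7 _ H₁-not-semiTransitive wr , representable⇒free t 7 _ H₂-not-semiTransitive wr
        , representable⇒free t 8 _ H₃-not-semiTransitive wr , representable⇒free t 8 _ H₄-not-semiTransitive wr
        , representable⇒free t 8 _ H₅-not-semiTransitive wr , representable⇒free t 8 _ H₆-not-semiTransitive wr)
  (λ (h₁ , _ , _ , h₄ , h₅ , _) → chain⇒representable t (free⇒chain t h₁ h₄ h₅))
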